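{- Let $n\ge 4$ and $2\le i\le\lfloor n/2\rfloor$. The subgroup $\mathbf{Z}_{C_i}$ of the $n\times n\times n$ Rubik's Cube group $\mathbf{G}$ consisting of the elements that fix every facelet outside the center corner orbit $i$ is isomorphic to the alternating group $\mathcal{A}_{24}$ (both for odd and for even $n$).
   Context: The $n\times n\times n$ Rubik's Cube has faces U, D, F, B, R, L, each an $n\times n$ grid of facelets carrying stickers ($6n^2$ in total). For $1\le k\le\lfloor n/2\rfloor$, $F_k,B_k,R_k,L_k,U_k,D_k$ denote clockwise (seen from the named face) $90^\circ$ rotations of the $k$-th $n\times n\times 1$ slice counted from the named face. $\mathbf{G}$ is the subgroup of the symmetric group on the facelets generated by the facelet permutations induced by these moves. On each face index facelets by $(r,c)$, $1\le r,c\le n$. For $2\le i\le\lfloor n/2\rfloor$, the center corner orbit $i$ is the set of 24 facelets $(r,c)$ with $r,c\in\{i,n+1-i\}$ on the six faces (these belong to one-sticker center cubies); $\mathbf{Z}_{C_i}$ acts on it by permutations. -}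

module Defs where

open import Data.Nat using (ℕ; zero; suc; _+_; _*_; _∸_; _≡ᵇ_)
open import Data.Nat.DivMod using (_/_)
open import Data.Integer as ℤ using (ℤ; +_; -_)
open import Data.Fin using (Fin; toℕ; zero; suc)
open import Data.Bool using (Bool; true; false; if_then_else_; _∨_; _∧_)
open import Data.Product using (Σ; _×_; _,_; ∃)
open import Data.Sum using (_⊎_)
open import Data.List using (List; []; _∷_; _++_; length)
open import Relation.Nullary using (¬_)
open import Relation.Nullary.Decidable using (⌊_⌋)
open import Relation.Binary.PropositionalEquality using (_≡_; _≢_)
open import Data.Fin.Permutation using (Permutation′; _⟨$⟩ʳ_; transpose)

-- Geometry.  Doubled coordinates: cubie centres of the n×n×n cube have
-- coordinates in {-(n-1), -(n-3), …, n-1}; the sticker (facelet) on the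
-- face with outward normal ±e_a sits at the point whose a-coordinate is
-- ±n and whose other two coordinates are those of its cubie.

Point : Set
Point = ℤ × ℤ × ℤ

-- Faces: 0 = R (+x), 1 = L (-x), 2 = U (+y), 3 = D (-y), 4 = F (+z), 5 = B (-z).
Face : Set
Face = Fin 6

-- Facelet (face, r, c) with 0-based row/column indices r, c ∈ Fin n
-- (the paper's (r+1, c+1)).
Facelet : ℕ → Set
Facelet n = Face × Fin n × Fin n

gridCoord : ℕ → ℕ → ℤ
gridCoord n j = + (2 * j) ℤ.- + (n ∸ 1)

embed : (n : ℕ) → Facelet n → Point
embed n (f , r , c) = go f
  where
  a = gridCoord n (toℕ r)
  b = gridCoord n (toℕ c)
  go : Face → Point
  go zero = (+ n , a , b)
  go (suc zero) = (- + n , a , b)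
  go (suc (suc zero)) = (a , + n , b)
  go (suc (suc (suc zero))) = (a , - + n , b)
  go (suc (suc (suc (suc zero)))) = (a , b , + n)
  go (suc (suc (suc (suc (suc zero))))) = (a , b , - + n)

normalCoord : Face → Point → ℤ
normalCoord zero (x , y , z) = x
normalCoord (suc zero) (x , y , z) = - x
normalCoord (suc (suc zero)) (x , y , z) = y
normalCoord (suc (suc (suc zero))) (x , y , z) = - y
normalCoord (suc (suc (suc (suc zero)))) (x , y , z) = z
normalCoord (suc (suc (suc (suc (suc zero))))) (x , y , z) = - z

-- 90° rotation of space about the normal axis of a face, clockwise as seen
-- from outside that face.
cw : Face → Point → Point
cw zero (x , y , z) = (x , z , - y)
cw (suc zero) (x , y , z) = (x , - z , y)
cw (suc (suc zero)) (x , y , z) = (- z , y , x)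
cw (suc (suc (suc zero))) (x , y , z) = (z , y , - x)
cw (suc (suc (suc (suc zero)))) (x , y , z) = (y , - x , z)
cw (suc (suc (suc (suc (suc zero))))) (x , y , z) = (- y , x , z)

-- Opposite face (rotation cw about it is the inverse of cw about the face).
opp : Face → Face
opp zero = suc zero
opp (suc zero) = zero
opp (suc (suc zero)) = suc (suc (suc zero))
opp (suc (suc (suc zero))) = suc (suc zero)
opp (suc (suc (suc (suc zero)))) = suc (suc (suc (suc (suc zero))))
opp (suc (suc (suc (suc (suc zero))))) = suc (suc (suc (suc zero)))
opp (suc (suc (suc (suc (suc (suc ()))))))

-- Does the point lie on (a sticker of) the k-th slice counted from face f?
-- Cubies of that slice have normal coordinate n+1-2k; for k = 1 the
-- stickers on face f itself (normal coordinate n) belong to it as well.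
inSlice : ℕ → Face → ℕ → Point → Bool
inSlice n f k p =
  ⌊ normalCoord f p ℤ.≟ + ((n + 1) ∸ (2 * k)) ⌋
  ∨ ((k ≡ᵇ 1) ∧ ⌊ normalCoord f p ℤ.≟ + n ⌋)

-- Generators of G (and their inverses): face f, slice index k = 1 + toℕ k'
-- with 1 ≤ k ≤ ⌊n/2⌋, and a flag: false = the move F_k, true = its inverse.
Letter : ℕ → Set
Letter n = Face × Fin (n / 2) × Bool

moveAct : (n : ℕ) → Letter n → Point → Point
moveAct n (f , k , inv) p =
  if inSlice n f (suc (toℕ k)) p
  then (if inv then cw (opp f) p else cw f p)
  else p

Word : ℕ → Set
Word n = List (Letter n)

act : (n : ℕ) → Word n → Point → Point
act n [] p = p
act n (m ∷ w) p = act n w (moveAct n m p)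

SameInG : (n : ℕ) → Word n → Word n → Set
SameInG n w v = (f : Facelet n) → act n w (embed n f) ≡ act n v (embed n f)

-- Center corner orbit i (1-based i): facelets (r,c) with r,c ∈ {i, n+1-i},
-- i.e. 0-based indices in {i-1, n-i}.
InOrbit : (n i : ℕ) → Facelet n → Set
InOrbit n i (f , r , c) =
  (toℕ r ≡ i ∸ 1 ⊎ toℕ r ≡ n ∸ i) × (toℕ c ≡ i ∸ 1 ⊎ toℕ c ≡ n ∸ i)

InZ : (n i : ℕ) → Word n → Set
InZ n i w = (f : Facelet n) → ¬ InOrbit n i f → act n w (embed n f) ≡ embed n f

Transp : ℕ → Set
Transp m = Σ (Fin m × Fin m) (λ { (a , b) → a ≢ b })

applyTs : {m : ℕ} → List (Transp m) → Fin m → Fin m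
applyTs [] x = x
applyTs (((a , b) , _) ∷ ts) x = transpose a b ⟨$⟩ʳ applyTs ts x

IsEven : {m : ℕ} → Permutation′ m → Set
IsEven {m} σ = Σ (List (Transp m)) λ ts →
  ∃ (λ k → length ts ≡ 2 * k) × ((x : Fin m) → σ ⟨$⟩ʳ x ≡ applyTs ts x)

-- A group isomorphism Z_{C_i} ≅ A_24 (group law of Z: composition of
-- facelet permutations; word w ++ v acts as first w then v, so the
-- permutation product in diagram order matches).

record ZIsoA24 (n i : ℕ) : Set where
  field
    φ      : Word n → Permutation′ 24
    φ-cong : (w v : Word n) → InZ n i w → InZ n i v → SameInG n w v →
             (x : Fin 24) → φ w ⟨$⟩ʳ x ≡ φ v ⟨$⟩ʳ x
    φ-hom  : (w v : Word n) → InZ n i w → InZ n i v →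
             (x : Fin 24) → φ (w ++ v) ⟨$⟩ʳ x ≡ φ v ⟨$⟩ʳ (φ w ⟨$⟩ʳ x)
    φ-inj  : (w v : Word n) → InZ n i w → InZ n i v →
             ((x : Fin 24) → φ w ⟨$⟩ʳ x ≡ φ v ⟨$⟩ʳ x) → SameInG n w v
    φ-even : (w : Word n) → InZ n i w → IsEven (φ w)
    φ-surj : (σ : Permutation′ 24) → IsEven σ →
             Σ (Word n) λ w → InZ n i w × ((x : Fin 24) → φ w ⟨$⟩ʳ x ≡ σ ⟨$⟩ʳ x)

{-# OPTIONS --safe #-}

-- Only the quarter turns of the outer layer and of layer i move the stickers of the
-- orbit i: the former act on it by one 4-cycle, the latter by two.  On the 24 corner
-- stickers an outer turn acts by three 4-cycles and every other turn trivially.  So the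
-- sign on the orbit equals the sign on the corner stickers, and the latter is trivial
-- for an element that moves nothing outside the orbit.
--
-- Conversely, a commutator of an outer turn with a conjugate of a turn of layer i is
-- a 3-cycle on the orbit and moves no other sticker; its conjugates include
-- all (0 x)(0 1), and these generate the alternating group.
--
-- Neither computation depends on n and i: a coordinate only matters through its sign and
-- through whether its absolute value is that of a face, of layer i, of the outer layer,
-- or none of these.  Hence all of it is evaluated on points with symbolic coordinates.
module Submission where

open import Defs
open import Data.Nat using (ℕ; _≤_)
open import Data.Nat.DivMod using (_/_)

open import Data.Bool using (Bool; true; false; if_then_else_; _∧_; _∨_; not)
open import Data.Bool.Properties using (∨-zeroʳ)
open import Data.Fin as Fin using (Fin; zero; suc; toℕ; fromℕ<; combine; remQuot)
open import Data.Fin.Patterns using (0F; 1F; 2F; 3F; 4F; 5F)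
open import Data.Fin.Permutation as Perm using (Permutation′; permutation; _⟨$⟩ʳ_; transpose; _∘ₚ_)
open import Data.Fin.Permutation.Components using (transpose-inverse)
import Data.Fin.Properties as Fin
open import Data.Integer as ℤ using (ℤ)
import Data.Integer.Properties as ℤ
open import Data.List using (List; []; _∷_; _++_; length; map; reverse; allFin; concatMap)
open import Data.List.Properties using (length-++)
open import Data.Maybe using (Maybe; just; nothing)
open import Data.Nat as ℕ using (zero; suc; _<_; s≤s; z≤n; _∸_; _≡ᵇ_; parity)
open import Data.Nat.DivMod using (m/n*n≤m)
import Data.Nat.Properties as ℕ
open import Data.Nat.Solver using (module +-*-Solver)
open import Data.Parity as ℙ using (Parity; 0ℙ; 1ℙ; _⁻¹)
import Data.Parity.Properties as ℙ
open import Data.Product using (Σ; ∃; _×_; _,_; proj₁; proj₂)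
open import Data.Product.Properties using (≡-dec)
open import Data.Sum using (_⊎_; inj₁; inj₂)
open import Data.Unit using (⊤; tt)
open import Data.Vec as Vec using (Vec; []; _∷_)
open import Function using (_∘_)
open import Relation.Binary.PropositionalEquality
open import Relation.Nullary using (Dec; yes; no; ¬_; contradiction)
open import Relation.Nullary.Decidable using (⌊_⌋; from-yes; ¬?; _×-dec_; _⊎-dec_; _→-dec_)

open import Algebra.Properties.CommutativeMonoid.Sum ℙ.+-0-commutativeMonoid using (sum; sum-permute; sum-cong-≗)
open import Algebra.Properties.CommutativeSemigroup ℙ.+-commutativeSemigroup using (x∙yz≈y∙xz)

open ≡-Reasoning

-- Transpositions and the sign of a product of transpositions

swap : ∀ {m} → Fin m → Fin m → Fin m → Fin m
swap a b x = transpose a b ⟨$⟩ʳ x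

swap-left : ∀ {m} (a b : Fin m) → swap a b a ≡ b
swap-left a b with a Fin.≟ a
... | yes _ = refl
... | no a≢a = contradiction refl a≢a

swap-right : ∀ {m} (a b : Fin m) → swap a b b ≡ a
swap-right a b with b Fin.≟ a
... | yes b≡a = b≡a
... | no _ with b Fin.≟ b
...   | yes _ = refl
...   | no b≢b = contradiction refl b≢b

swap-other : ∀ {m} {a b x : Fin m} → x ≢ a → x ≢ b → swap a b x ≡ x
swap-other {a = a} {b} {x} x≢a x≢b with x Fin.≟ a
... | yes x≡a = contradiction x≡a x≢a
... | no _ with x Fin.≟ b
...   | yes x≡b = contradiction x≡b x≢b
...   | no _ = refl

swap-comm : ∀ {m} (a b x : Fin m) → swap a b x ≡ swap b a x
swap-comm a b x with x Fin.≟ a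
... | yes refl = sym (swap-right b x)
... | no x≢a with x Fin.≟ b
...   | yes _ = refl
...   | no x≢b with x Fin.≟ a
...     | yes x≡a = contradiction x≡a x≢a
...     | no _ = refl

swap-involutive : ∀ {m} (a b x : Fin m) → swap a b (swap a b x) ≡ x
swap-involutive a b x = trans (cong (swap a b) (swap-comm a b x)) (transpose-inverse a b)

swap-injective : ∀ {m} (a b : Fin m) {x y} → swap a b x ≡ swap a b y → x ≡ y
swap-injective a b {x} {y} eq =
  trans (sym (swap-involutive a b x)) (trans (cong (swap a b) eq) (swap-involutive a b y))

swap-natural : ∀ {m k} (π : Fin m → Fin k) → (∀ {x y} → π x ≡ π y → x ≡ y) →
               ∀ a b x → π (swap a b x) ≡ swap (π a) (π b) (π x)
swap-natural π π-inj a b x with x Fin.≟ a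
... | yes refl = sym (swap-left (π x) (π b))
... | no x≢a with x Fin.≟ b
...   | yes refl = sym (swap-right (π a) (π x))
...   | no x≢b = sym (swap-other (x≢a ∘ π-inj) (x≢b ∘ π-inj))

-- Conjugation by `swap c a` relabels `c` as `a` and leaves `b`, which differs from both, in place.
swap-conj : ∀ {m} {c a b : Fin m} → b ≢ c → b ≢ a →
            ∀ x → swap a b x ≡ swap c a (swap c b (swap c a x))
swap-conj {c = c} {a} {b} b≢c b≢a x = begin
  swap a b x                                               ≡⟨ cong₂ (λ u v → swap u v x) (swap-left c a) (swap-other b≢c b≢a) ⟨
  swap (swap c a c) (swap c a b) x                         ≡⟨ cong (swap (swap c a c) (swap c a b)) (swap-involutive c a x) ⟨
  swap (swap c a c) (swap c a b) (swap c a (swap c a x))   ≡⟨ swap-natural (swap c a) (swap-injective c a) c b (swap c a x) ⟨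
  swap c a (swap c b (swap c a x))                         ∎

-- Inversions modulo 2

less : ℕ → ℕ → Parity
less _       zero    = 0ℙ
less zero    (suc _) = 1ℙ
less (suc a) (suc b) = less a b

less-flip : ∀ {a b} → a ≢ b → less a b ≡ less b a ⁻¹
less-flip {zero}  {zero}  a≢b = contradiction refl a≢b
less-flip {zero}  {suc b} _   = refl
less-flip {suc a} {zero}  _   = refl
less-flip {suc a} {suc b} a≢b = less-flip (a≢b ∘ cong suc)

-- The parity of the number of inversions. An arbitrary `ℕ`-valued `f` is allowed, rather than a
-- permutation, so that the recursion can pass to the tail `f ∘ suc`.
inversions : ∀ {m} → (Fin m → ℕ) → Parity
inversions {zero}  f = 0ℙ
inversions {suc m} f = sum (λ j → less (f (suc j)) (f zero)) ℙ.+ inversions (f ∘ suc)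

inversions-cong : ∀ {m} {f g : Fin m → ℕ} → (∀ x → f x ≡ g x) → inversions f ≡ inversions g
inversions-cong {zero}  f≗g = refl
inversions-cong {suc m} f≗g =
  cong₂ ℙ._+_ (sum-cong-≗ (λ j → cong₂ less (f≗g (suc j)) (f≗g zero))) (inversions-cong (f≗g ∘ suc))

+-⁻¹ : ∀ p q → p ⁻¹ ℙ.+ q ≡ (p ℙ.+ q) ⁻¹
+-⁻¹ 0ℙ q = refl
+-⁻¹ 1ℙ q = sym (ℙ.⁻¹-involutive q)

-- Only the comparison of the first two values with each other is reversed; their comparisons with
-- later values merely trade places.
inversions-swap-head : ∀ {m} (f : Fin (2 ℕ.+ m) → ℕ) → f zero ≢ f (suc zero) →
                       inversions (f ∘ swap zero (suc zero)) ≡ inversions f ⁻¹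
inversions-swap-head f f₀≢f₁ rewrite less-flip f₀≢f₁ = exchange (less (f (suc zero)) (f zero)) _ _ _
  where
  exchange : ∀ p s t r → p ⁻¹ ℙ.+ t ℙ.+ (s ℙ.+ r) ≡ (p ℙ.+ s ℙ.+ (t ℙ.+ r)) ⁻¹
  exchange p s t r = begin
    p ⁻¹ ℙ.+ t ℙ.+ (s ℙ.+ r)    ≡⟨ ℙ.+-assoc (p ⁻¹) t (s ℙ.+ r) ⟩
    p ⁻¹ ℙ.+ (t ℙ.+ (s ℙ.+ r))  ≡⟨ +-⁻¹ p _ ⟩
    (p ℙ.+ (t ℙ.+ (s ℙ.+ r))) ⁻¹ ≡⟨ cong (λ q → (p ℙ.+ q) ⁻¹) (x∙yz≈y∙xz t s r) ⟩
    (p ℙ.+ (s ℙ.+ (t ℙ.+ r))) ⁻¹ ≡⟨ cong _⁻¹ (ℙ.+-assoc p s (t ℙ.+ r)) ⟨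
    (p ℙ.+ s ℙ.+ (t ℙ.+ r)) ⁻¹ ∎

inversions-swap : ∀ {m} (f : Fin m → ℕ) → (∀ {x y} → f x ≡ f y → x ≡ y) →
                  ∀ {a b} → a ≢ b → inversions (f ∘ swap a b) ≡ inversions f ⁻¹

-- The comparisons with the head are summed over all later positions, so the transposition only
-- permutes that sum; the reversal comes from the tail.
inversions-swap-suc : ∀ {m} (f : Fin (suc m) → ℕ) → (∀ {x y} → f x ≡ f y → x ≡ y) →
                      ∀ {a b} → a ≢ b → inversions (f ∘ swap (suc a) (suc b)) ≡ inversions f ⁻¹
inversions-swap-suc f f-inj {a} {b} a≢b = begin
  sum (λ j → less (f (swap (suc a) (suc b) (suc j))) (f zero)) ℙ.+ inversions (f ∘ swap (suc a) (suc b) ∘ suc)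
    ≡⟨ cong₂ ℙ._+_ (sum-cong-≗ (λ j → cong (λ x → less (f x) (f zero)) (shift j))) (inversions-cong (λ j → cong f (shift j))) ⟩
  sum (λ j → less (f (suc (swap a b j))) (f zero)) ℙ.+ inversions (f ∘ suc ∘ swap a b)
    ≡⟨ cong₂ ℙ._+_ (sym (sum-permute (λ j → less (f (suc j)) (f zero)) (transpose a b)))
                   (inversions-swap (f ∘ suc) (Fin.suc-injective ∘ f-inj) a≢b) ⟩
  below ℙ.+ inversions (f ∘ suc) ⁻¹
    ≡⟨ ℙ.+-comm below _ ⟩
  inversions (f ∘ suc) ⁻¹ ℙ.+ below
    ≡⟨ +-⁻¹ (inversions (f ∘ suc)) below ⟩
  (inversions (f ∘ suc) ℙ.+ below) ⁻¹
    ≡⟨ cong _⁻¹ (ℙ.+-comm (inversions (f ∘ suc)) below) ⟩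
  inversions f ⁻¹ ∎
  where
  below = sum (λ j → less (f (suc j)) (f zero))
  shift : ∀ j → swap (suc a) (suc b) (suc j) ≡ suc (swap a b j)
  shift j = sym (swap-natural suc Fin.suc-injective a b j)

-- A transposition of 0 with a position beyond 1 is the conjugate by `(0 1)` of one that avoids 0,
-- so the parity is reversed three times.
inversions-swap-zero : ∀ {m} (f : Fin (suc m) → ℕ) → (∀ {x y} → f x ≡ f y → x ≡ y) →
                       ∀ b → inversions (f ∘ swap zero (suc b)) ≡ inversions f ⁻¹
inversions-swap-zero f f-inj zero = inversions-swap-head f ((λ ()) ∘ f-inj)
inversions-swap-zero f f-inj (suc b) = begin
  inversions (f ∘ swap zero (suc (suc b)))  ≡⟨ inversions-cong (λ x → cong f (conj x)) ⟩
  inversions (f ∘ σ ∘ τ ∘ σ)                ≡⟨ inversions-swap-head (f ∘ σ ∘ τ) ((λ ()) ∘ f-inj {suc zero} {suc (suc b)}) ⟩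
  inversions (f ∘ σ ∘ τ) ⁻¹                 ≡⟨ cong _⁻¹ (inversions-swap-suc (f ∘ σ) (swap-injective zero (suc zero) ∘ f-inj) {zero} {suc b} (λ ())) ⟩
  inversions (f ∘ σ) ⁻¹ ⁻¹                  ≡⟨ ℙ.⁻¹-involutive _ ⟩
  inversions (f ∘ σ)                        ≡⟨ inversions-swap-head f ((λ ()) ∘ f-inj) ⟩
  inversions f ⁻¹                           ∎
  where
  σ = swap zero (suc zero)
  τ = swap (suc zero) (suc (suc b))
  conj : ∀ x → swap zero (suc (suc b)) x ≡ σ (τ (σ x))
  conj x = begin
    swap zero (suc (suc b)) x                              ≡⟨ swap-conj {c = suc zero} (λ ()) (λ ()) x ⟩
    swap (suc zero) zero (τ (swap (suc zero) zero x))      ≡⟨ swap-comm (suc zero) zero (τ (swap (suc zero) zero x)) ⟩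
    σ (τ (swap (suc zero) zero x))                         ≡⟨ cong (σ ∘ τ) (swap-comm (suc zero) zero x) ⟩
    σ (τ (σ x))                                            ∎

inversions-swap f f-inj {zero}  {zero}  a≢b = contradiction refl a≢b
inversions-swap f f-inj {zero}  {suc b} a≢b = inversions-swap-zero f f-inj b
inversions-swap f f-inj {suc a} {zero}  a≢b =
  trans (inversions-cong (λ x → cong f (swap-comm (suc a) zero x))) (inversions-swap-zero f f-inj a)
inversions-swap f f-inj {suc a} {suc b} a≢b = inversions-swap-suc f f-inj (a≢b ∘ cong suc)

parity-suc : ∀ k → parity (suc k) ≡ parity k ⁻¹
parity-suc k = trans (sym (ℙ.⁻¹-involutive _)) (cong _⁻¹ (ℙ.suc-homo-⁻¹ k))

-- Stated for every injective `f` because the induction absorbs the leading transposition of the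
-- list into `f`.
inversions-applyTs : ∀ {m} (f : Fin m → ℕ) → (∀ {x y} → f x ≡ f y → x ≡ y) →
                     (ts : List (Transp m)) → inversions (f ∘ applyTs ts) ≡ parity (length ts) ℙ.+ inversions f
inversions-applyTs f f-inj [] = refl
inversions-applyTs f f-inj (((a , b) , a≢b) ∷ ts) = begin
  inversions (f ∘ swap a b ∘ applyTs ts)            ≡⟨ inversions-applyTs (f ∘ swap a b) (swap-injective a b ∘ f-inj) ts ⟩
  parity (length ts) ℙ.+ inversions (f ∘ swap a b)  ≡⟨ cong (parity (length ts) ℙ.+_) (inversions-swap f f-inj a≢b) ⟩
  parity (length ts) ℙ.+ inversions f ⁻¹            ≡⟨ shift (parity (length ts)) (inversions f) ⟩
  parity (length ts) ⁻¹ ℙ.+ inversions f            ≡⟨ cong (ℙ._+ inversions f) (parity-suc (length ts)) ⟨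
  parity (suc (length ts)) ℙ.+ inversions f         ∎
  where
  shift : ∀ p q → p ℙ.+ q ⁻¹ ≡ p ⁻¹ ℙ.+ q
  shift 0ℙ q = refl
  shift 1ℙ q = ℙ.⁻¹-involutive q

-- The inversions of the identity cancel in `inversions-applyTs`. This will be applied to the corner
-- stickers.
identity-even : ∀ {m} (ts : List (Transp m)) → (∀ x → applyTs ts x ≡ x) → parity (length ts) ≡ 0ℙ
identity-even {m} ts ts-id = ℙ.+-cancelʳ-≡ (inversions (toℕ {m})) _ _
  (trans (sym (inversions-applyTs toℕ Fin.toℕ-injective ts)) (inversions-cong (λ x → cong toℕ (ts-id x))))

applyTs-++ : ∀ {m} (ts us : List (Transp m)) x → applyTs (ts ++ us) x ≡ applyTs ts (applyTs us x)
applyTs-++ []                    us x = refl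
applyTs-++ (((a , b) , _) ∷ ts) us x = cong (swap a b) (applyTs-++ ts us x)

-- The symbolic cube

Sign Base Sym SymPoint : Set
Sign = Fin 2
Base = Fin 5
Sym = Sign × Base
SymPoint = Sym × Sym × Sym

pattern + = 0F
pattern - = 1F

-- Absolute values of coordinates: N for a face (n), A for layer i (n + 1 - 2i), E for
-- the outer layer (n - 1), X and Y for two further distances, one per grid direction.
pattern N = 0F
pattern A = 1F
pattern E = 2F
pattern X = 3F
pattern Y = 4F

_≟ₛ_ : (p q : SymPoint) → Dec (p ≡ q)
_≟ₛ_ = ≡-dec sym? (≡-dec sym? sym?)
  where sym? = ≡-dec Fin._≟_ Fin._≟_

negate : Sym → Sym
negate (+ , b) = (- , b)
negate (- , b) = (+ , b)

facePoint : Face → Sym → Sym → SymPoint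
facePoint 0F a b = ((+ , N) , a , b)
facePoint 1F a b = ((- , N) , a , b)
facePoint 2F a b = (a , (+ , N) , b)
facePoint 3F a b = (a , (- , N) , b)
facePoint 4F a b = (a , b , (+ , N))
facePoint 5F a b = (a , b , (- , N))

normalₛ : Face → SymPoint → Sym
normalₛ 0F (x , y , z) = x
normalₛ 1F (x , y , z) = negate x
normalₛ 2F (x , y , z) = y
normalₛ 3F (x , y , z) = negate y
normalₛ 4F (x , y , z) = z
normalₛ 5F (x , y , z) = negate z

cwₛ : Face → SymPoint → SymPoint
cwₛ 0F (x , y , z) = (x , z , negate y)
cwₛ 1F (x , y , z) = (x , negate z , y)
cwₛ 2F (x , y , z) = (negate z , y , x)
cwₛ 3F (x , y , z) = (z , y , negate x)
cwₛ 4F (x , y , z) = (y , negate x , z)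
cwₛ 5F (x , y , z) = (negate y , x , z)

data Depth : Set where
  outer inner : Depth

-- Slices are counted only up to the middle, so those counted from a face lie on its positive side;
-- the outer one also contains the stickers on the face itself. `X` and `Y` stand for distances that
-- neither layer meets.
hits : Depth → Sym → Bool
hits outer (+ , N) = true
hits outer (+ , E) = true
hits inner (+ , A) = true
hits _     _       = false

SymLetter SymWord : Set
SymLetter = Face × Depth × Bool
SymWord = List SymLetter

moveₛ : SymLetter → SymPoint → SymPoint
moveₛ (f , d , inv) p =
  if hits d (normalₛ f p) then (if inv then cwₛ (opp f) p else cwₛ f p) else p

actₛ : SymWord → SymPoint → SymPoint
actₛ []      p = p
actₛ (l ∷ w) p = actₛ w (moveₛ l p)

-- `centre` is the orbit and `corner` the set of stickers of the corner cubies. Both have one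
-- sticker for each face and pair of signs, so the same 24 labels serve for both.
data Shell : Set where
  centre corner : Shell

shellBase : Shell → Base
shellBase centre = A
shellBase corner = E

cell : Face → Sign → Sign → Fin 24
cell f s t = combine f (combine s t)

coordinates : Fin 24 → Face × Sign × Sign
coordinates x = (proj₁ (remQuot {6} 4 x) , remQuot {2} 2 (proj₂ (remQuot {6} 4 x)))

coordinates-cell : ∀ f s t → coordinates (cell f s t) ≡ (f , s , t)
coordinates-cell = from-yes (Fin.all? λ f → Fin.all? λ s → Fin.all? λ t →
  ≡-dec Fin._≟_ (≡-dec Fin._≟_ Fin._≟_) (coordinates (cell f s t)) (f , s , t))

cellFace : Fin 24 → Face
cellFace = proj₁ ∘ coordinates

cellSign₁ cellSign₂ : Fin 24 → Sign
cellSign₁ = proj₁ ∘ proj₂ ∘ coordinates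
cellSign₂ = proj₂ ∘ proj₂ ∘ coordinates

point : Shell → Fin 24 → SymPoint
point h x = facePoint (cellFace x) (cellSign₁ x , shellBase h) (cellSign₂ x , shellBase h)

-- Only meaningful on points with exactly one coordinate ±N.
locate : SymPoint → Fin 24
locate ((+ , N) , (s , _) , (t , _)) = cell 0F s t
locate ((- , N) , (s , _) , (t , _)) = cell 1F s t
locate ((s , _) , (+ , N) , (t , _)) = cell 2F s t
locate ((s , _) , (- , N) , (t , _)) = cell 3F s t
locate ((s , _) , (t , _) , (+ , _)) = cell 4F s t
locate ((s , _) , (t , _) , (- , _)) = cell 5F s t

locate-point : ∀ h x → locate (point h x) ≡ x
locate-point centre = from-yes (Fin.all? λ x → locate (point centre x) Fin.≟ x)
locate-point corner = from-yes (Fin.all? λ x → locate (point corner x) Fin.≟ x)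

step : Shell → SymLetter → Fin 24 → Fin 24
step h l x = locate (moveₛ l (point h x))

inverse : SymLetter → SymLetter
inverse (f , d , inv) = (f , d , not inv)

-- `locate` discards the distances; the first equation says that the turned point really is the
-- point of the same shell with the label found.
StepSpec : Shell → SymLetter → Fin 24 → Set
StepSpec h l x = point h (step h l x) ≡ moveₛ l (point h x)
               × step h (inverse l) (step h l x) ≡ x

step-spec : ∀ h l x → StepSpec h l x
step-spec h (f , d , inv) = check h d inv f
  where
  table? : ∀ h d inv → Dec (∀ f x → StepSpec h (f , d , inv) x)
  table? h d inv = Fin.all? λ f → Fin.all? λ x →
    (point h (step h (f , d , inv) x) ≟ₛ moveₛ (f , d , inv) (point h x)) ×-dec
    (step h (f , d , not inv) (step h (f , d , inv) x) Fin.≟ x)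
  -- Faces and cells are searched by `Fin.all?`; the other parameters are split by hand, which makes
  -- each table closed and decidable by evaluation.
  check : ∀ h d inv f x → StepSpec h (f , d , inv) x
  check centre outer false = from-yes (table? centre outer false)
  check centre outer true  = from-yes (table? centre outer true)
  check centre inner false = from-yes (table? centre inner false)
  check centre inner true  = from-yes (table? centre inner true)
  check corner outer false = from-yes (table? corner outer false)
  check corner outer true  = from-yes (table? corner outer true)
  check corner inner false = from-yes (table? corner inner false)
  check corner inner true  = from-yes (table? corner inner true)

inverse-involutive : ∀ l → inverse (inverse l) ≡ l
inverse-involutive (f , d , false) = refl
inverse-involutive (f , d , true)  = refl

stepPerm : Shell → SymLetter → Permutation′ 24
stepPerm h l = permutation (step h l) (step h (inverse l))
  (λ x → subst (λ k → step h k (step h (inverse l) x) ≡ x) (inverse-involutive l) (proj₂ (step-spec h (inverse l) x)))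
  (λ x → proj₂ (step-spec h l x))

-- Quarter turns as products of transpositions

transp : ∀ {m} → Fin m → Fin m → List (Transp m)
transp a b with a Fin.≟ b
-- At a fixed point of a turn all four arguments of `cycle` coincide, and the decomposition must
-- then be empty.
... | yes _  = []
... | no a≢b = ((a , b) , a≢b) ∷ []

cycle : ∀ {m} → Fin m → Fin m → Fin m → Fin m → List (Transp m)
cycle a b c d =
  if a ≤ᵇ b ∧ a ≤ᵇ c ∧ a ≤ᵇ d then transp a b ++ transp b c ++ transp c d else []
  where
  infix 7 _≤ᵇ_
  _≤ᵇ_ : ∀ {m} → Fin m → Fin m → Bool
  a ≤ᵇ b = toℕ a ℕ.≤ᵇ toℕ b

-- A decomposition (a ga)(ga g²a)(g²a g³a) is emitted only at the least element a of a
-- cycle; a quarter turn has cycles of lengths 1 and 4 only.  The local functions make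
-- the evaluator share the iterates of g.
cycleTs : ∀ {m} → (Fin m → Fin m) → Fin m → List (Transp m)
cycleTs g a = from₁ (g a)
  where
  from₂ = λ b c → cycle a b c (g c)
  from₁ = λ b → from₂ b (g b)

stepTs : Shell → SymLetter → List (Transp 24)
stepTs h l = concatMap (cycleTs (step h l)) (allFin 24)

-- That one value serves both shells is the equality of signs: the numbers of 4-cycles on `centre`
-- and `corner` are 1 and 3 for an outer turn, 2 and 0 for an inner one.
depthParity : Depth → Parity
depthParity outer = 1ℙ
depthParity inner = 0ℙ

Decomposes : Depth → (Fin 24 → Fin 24) → List (Transp 24) → Set
Decomposes d g ts = parity (length ts) ≡ depthParity d × (∀ x → g x ≡ applyTs ts x)

-- A separate function of ts, so that the evaluator computes ts only once.
decomposes? : ∀ d g ts → Dec (Decomposes d g ts)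
decomposes? d g ts = (parity (length ts) ℙ.≟ depthParity d) ×-dec (Fin.all? λ x → g x Fin.≟ applyTs ts x)

stepTs-spec : ∀ h f d inv → Decomposes d (step h (f , d , inv)) (stepTs h (f , d , inv))
stepTs-spec h f d inv = check h d inv f
  where
  table? : ∀ h d inv → Dec (∀ f → Decomposes d (step h (f , d , inv)) (stepTs h (f , d , inv)))
  table? h d inv = Fin.all? λ f → decomposes? d (step h (f , d , inv)) (stepTs h (f , d , inv))
  check : ∀ h d inv f → Decomposes d (step h (f , d , inv)) (stepTs h (f , d , inv))
  check centre outer false = from-yes (table? centre outer false)
  check centre outer true  = from-yes (table? centre outer true)
  check centre inner false = from-yes (table? centre inner false)
  check centre inner true  = from-yes (table? centre inner true)
  check corner outer false = from-yes (table? corner outer false)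
  check corner outer true  = from-yes (table? corner outer true)
  check corner inner false = from-yes (table? corner inner false)
  check corner inner true  = from-yes (table? corner inner true)

-- Words for the three-cycles

-- Singmaster notation, with lower case for the turns of layer i.
R R′ r r′ L L′ l′ U U′ u u′ D′ d d′ F f f′ b b′ : SymLetter
R  = (0F , outer , false)
R′ = (0F , outer , true)
r  = (0F , inner , false)
r′ = (0F , inner , true)
L  = (1F , outer , false)
L′ = (1F , outer , true)
l′ = (1F , inner , true)
U  = (2F , outer , false)
U′ = (2F , outer , true)
u  = (2F , inner , false)
u′ = (2F , inner , true)
D′ = (3F , outer , true)
d  = (3F , inner , false)
d′ = (3F , inner , true)
F  = (4F , outer , false)
f  = (4F , inner , false)
f′ = (4F , inner , true)
b  = (5F , inner , false)
b′ = (5F , inner , true)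

-- r′ d r moves a single sticker of the U layer, so its commutator with U is a 3-cycle.
commutator : SymWord
commutator = r′ ∷ d ∷ r ∷ U ∷ r′ ∷ d′ ∷ r ∷ U′ ∷ []

-- Found by breadth-first search: the word at position j moves cells 0, 1 and j + 2
-- onto the cycle of the commutator.
setups : Vec SymWord 22
setups =
  (u ∷ F ∷ r ∷ f′ ∷ L ∷ []) ∷
  (u ∷ F ∷ d′ ∷ r ∷ []) ∷
  (f ∷ u ∷ u ∷ U′ ∷ f ∷ []) ∷
  (b′ ∷ D′ ∷ f ∷ L′ ∷ f ∷ []) ∷
  (R ∷ d ∷ d ∷ b ∷ U ∷ []) ∷
  (f′ ∷ U′ ∷ L′ ∷ R ∷ b ∷ []) ∷
  (u ∷ u ∷ b′ ∷ L ∷ []) ∷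
  (f ∷ u ∷ u ∷ f ∷ []) ∷
  (f′ ∷ U′ ∷ R ∷ b ∷ []) ∷
  (b′ ∷ u ∷ F ∷ r ∷ d′ ∷ []) ∷
  (f′ ∷ R′ ∷ f′ ∷ U′ ∷ []) ∷
  (b ∷ R ∷ b ∷ U ∷ L′ ∷ []) ∷
  (R′ ∷ f′ ∷ U′ ∷ f′ ∷ L ∷ []) ∷
  (u ∷ b ∷ F ∷ d′ ∷ r ∷ []) ∷
  (u ∷ f ∷ u ∷ b′ ∷ L ∷ []) ∷
  (u ∷ u ∷ r ∷ b′ ∷ L ∷ []) ∷
  (u ∷ u ∷ r′ ∷ b′ ∷ L ∷ []) ∷
  (b ∷ U ∷ l′ ∷ R′ ∷ f′ ∷ []) ∷
  (r′ ∷ u ∷ u ∷ b′ ∷ L ∷ []) ∷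
  (u ∷ r′ ∷ f ∷ l′ ∷ U ∷ []) ∷
  (u′ ∷ f ∷ u′ ∷ b′ ∷ L ∷ []) ∷
  (R ∷ d′ ∷ b ∷ d′ ∷ U ∷ []) ∷
  []

conjugate : SymWord → SymWord → SymWord
conjugate s w = s ++ w ++ reverse (map inverse s)

-- The index `j` stands for the cell `suc j`. For cell 1 the product `(0 1)(0 1)` is the identity,
-- hence the empty word.
threeCycle : Fin 23 → SymWord
threeCycle zero    = []
threeCycle (suc j) = conjugate (Vec.lookup setups j) commutator

run : SymWord → Fin 24 → Fin 24
run []      x = x
run (l ∷ w) x = run w (step centre l x)

run-threeCycle : ∀ j x → run (threeCycle j) x ≡ swap 0F (suc j) (swap 0F 1F x)
run-threeCycle = from-yes (Fin.all? λ j → Fin.all? λ x → run (threeCycle j) x Fin.≟ swap 0F (suc j) (swap 0F 1F x))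

slot₁ slot₂ : Fin 3 → Base
slot₁ 0F = A
slot₁ 1F = E
slot₁ 2F = X
slot₂ 0F = A
slot₂ 1F = E
slot₂ 2F = Y

-- A finite check that covers all facelets of all sizes: up to sign, a grid coordinate is at the
-- distance of layer `i`, of the outer layer, or at one that these turns miss. The excluded pair of
-- slots is the orbit.
threeCycle-fixes : ∀ j f s t b c → ¬ (b ≡ 0F × c ≡ 0F) →
                   actₛ (threeCycle j) (facePoint f (s , slot₁ b) (t , slot₂ c)) ≡ facePoint f (s , slot₁ b) (t , slot₂ c)
threeCycle-fixes = from-yes
  (Fin.all? λ j → Fin.all? λ f → Fin.all? λ s → Fin.all? λ t → Fin.all? λ b → Fin.all? λ c →
    ¬? ((b Fin.≟ 0F) ×-dec (c Fin.≟ 0F)) →-dec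
    (actₛ (threeCycle j) (facePoint f (s , slot₁ b) (t , slot₂ c)) ≟ₛ facePoint f (s , slot₁ b) (t , slot₂ c)))

star : Fin 23 → Fin 24 → Fin 24
star j = swap 0F (suc j)

τ : Fin 24 → Fin 24
τ = swap 0F 1F

swap-stars : ∀ {a b} → a ≢ b → ∀ x → star a (star b (star a x)) ≡ swap (suc a) (suc b) x
swap-stars a≢b x = sym (swap-conj (λ ()) (a≢b ∘ sym ∘ Fin.suc-injective) x)

-- The n × n × n cube

isYes-true : ∀ {P : Set} (d : Dec P) → P → ⌊ d ⌋ ≡ true
isYes-true (yes _) _ = refl
isYes-true (no ¬p) p = contradiction p ¬p

isYes-false : ∀ {P : Set} (d : Dec P) → ¬ P → ⌊ d ⌋ ≡ false
isYes-false (yes p) ¬p = contradiction p ¬p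
isYes-false (no _)  _  = refl

signed : Sign → ℕ → ℤ
signed + m = ℤ.+ m
signed - m = ℤ.- ℤ.+ m

signed-injective : ∀ {s t a b} → 0 < a → 0 < b → signed s a ≡ signed t b → s ≡ t × a ≡ b
signed-injective {+} {+} _ _ eq = refl , ℤ.+-injective eq
signed-injective { - } { - } _ _ eq = refl , ℤ.+-injective (ℤ.neg-injective eq)
signed-injective {+} { - } {suc _} {suc _} _ _ ()
signed-injective { - } {+} {suc _} {suc _} _ _ ()

minus≢plus : ∀ {a b} → 0 < b → signed - a ≢ signed + b
minus≢plus {zero} {suc _} _ ()
minus≢plus {suc _} {suc _} _ ()

base : Sym → Base
base = proj₂

base-negate : ∀ s → base (negate s) ≡ base s
base-negate (+ , b) = refl
base-negate (- , b) = refl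

even-half : ∀ k → parity k ≡ 0ℙ → ∃ λ m → k ≡ 2 ℕ.* m
even-half zero          _    = 0 , refl
even-half (suc (suc k)) even with m , refl ← even-half k even = suc m , sym (ℕ.*-suc 2 m)

length-++-parity : ∀ {B : Set} (xs ys : List B) →
                   parity (length (xs ++ ys)) ≡ parity (length xs) ℙ.+ parity (length ys)
length-++-parity xs ys = trans (cong parity (length-++ xs)) (ℙ.+-homo-+ (length xs) (length ys))

-- The size is a successor by construction, so that `n ∸ 1` in `gridCoord` reduces.
module Cube (n-1 i : ℕ) (2≤i : 2 ≤ i) (i≤n/2 : i ≤ suc n-1 / 2) where

  n : ℕ
  n = suc n-1

  -- Distances of the layers

  slice : ℕ → ℕ
  slice k = (n ℕ.+ 1) ∸ (2 ℕ.* k)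

  Level : ℕ → Set
  Level k = 1 ≤ k × 2 ℕ.* k ≤ n

  half-level : ∀ {k} → 1 ≤ k → k ≤ n / 2 → Level k
  half-level {k} 1≤k k≤n/2 = 1≤k , ℕ.≤-trans
    (subst (2 ℕ.* k ≤_) (ℕ.*-comm 2 (n / 2)) (ℕ.*-monoʳ-≤ 2 k≤n/2)) (m/n*n≤m n 2)

  1≤i : 1 ≤ i
  1≤i = ℕ.≤-trans (s≤s z≤n) 2≤i

  1≤n/2 : 1 ≤ n / 2
  1≤n/2 = ℕ.≤-trans 1≤i i≤n/2

  level-1 : Level 1
  level-1 = half-level (s≤s z≤n) 1≤n/2

  level-i : Level i
  level-i = half-level 1≤i i≤n/2

  i≢1 : i ≢ 1
  i≢1 = ℕ.>⇒≢ 2≤i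

  slice+2k : ∀ {k} → Level k → slice k ℕ.+ 2 ℕ.* k ≡ n ℕ.+ 1
  slice+2k (_ , 2k≤n) = ℕ.m∸n+n≡m (ℕ.m≤n⇒m≤n+o 1 2k≤n)

  slice-positive : ∀ {k} → Level k → 0 < slice k
  slice-positive {k} (_ , 2k≤n) = ℕ.m<n⇒0<n∸m (subst (2 ℕ.* k <_) (ℕ.+-comm 1 n) (s≤s 2k≤n))

  slice-injective : ∀ {j k} → Level j → Level k → slice j ≡ slice k → j ≡ k
  slice-injective {j} {k} (_ , 2j≤n) (_ , 2k≤n) eq =
    ℕ.*-cancelˡ-≡ j k 2 (ℕ.∸-cancelˡ-≡ (ℕ.m≤n⇒m≤n+o 1 2j≤n) (ℕ.m≤n⇒m≤n+o 1 2k≤n) eq)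

  -- The distance `n + 1 - 2k` of a layer and the distance `n` of a face differ in parity: equality
  -- would give `2k = 1`.
  slice≢n : ∀ {k} → Level k → slice k ≢ n
  slice≢n {k} lvl eq = ℕ.even≢odd k 0 (ℕ.+-cancelˡ-≡ n _ _ (subst (λ m → m ℕ.+ 2 ℕ.* k ≡ n ℕ.+ 1) eq (slice+2k lvl)))

  -- Grid indices and signed distances

  open +-*-Solver using (solve; _:+_; _:*_; _:=_; con)

  plus-index : ∀ {k j} → Level k → 2 ℕ.* j ≡ slice k ℕ.+ n-1 → j ℕ.+ k ≡ n
  plus-index {k} {j} lvl eq = ℕ.*-cancelˡ-≡ (j ℕ.+ k) n 2 (begin
    2 ℕ.* (j ℕ.+ k)                 ≡⟨ ℕ.*-distribˡ-+ 2 j k ⟩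
    2 ℕ.* j ℕ.+ 2 ℕ.* k             ≡⟨ cong (ℕ._+ 2 ℕ.* k) eq ⟩
    slice k ℕ.+ n-1 ℕ.+ 2 ℕ.* k     ≡⟨ solve 3 (λ s p q → s :+ p :+ q := s :+ q :+ p) refl (slice k) n-1 (2 ℕ.* k) ⟩
    slice k ℕ.+ 2 ℕ.* k ℕ.+ n-1     ≡⟨ cong (ℕ._+ n-1) (slice+2k lvl) ⟩
    n ℕ.+ 1 ℕ.+ n-1                 ≡⟨ solve 1 (λ p → con 1 :+ p :+ con 1 :+ p := con 2 :* (con 1 :+ p)) refl n-1 ⟩
    2 ℕ.* n                         ∎)

  index-plus : ∀ {k j} → Level k → j ℕ.+ k ≡ n → 2 ℕ.* j ≡ slice k ℕ.+ n-1
  index-plus {k} {j} lvl eq = ℕ.+-cancelʳ-≡ (2 ℕ.* k) _ _ (begin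
    2 ℕ.* j ℕ.+ 2 ℕ.* k             ≡⟨ ℕ.*-distribˡ-+ 2 j k ⟨
    2 ℕ.* (j ℕ.+ k)                 ≡⟨ cong (2 ℕ.*_) eq ⟩
    2 ℕ.* n                         ≡⟨ solve 1 (λ p → con 2 :* (con 1 :+ p) := con 1 :+ p :+ con 1 :+ p) refl n-1 ⟩
    n ℕ.+ 1 ℕ.+ n-1                 ≡⟨ cong (ℕ._+ n-1) (slice+2k lvl) ⟨
    slice k ℕ.+ 2 ℕ.* k ℕ.+ n-1     ≡⟨ solve 3 (λ s p q → s :+ q :+ p := s :+ p :+ q) refl (slice k) n-1 (2 ℕ.* k) ⟩
    slice k ℕ.+ n-1 ℕ.+ 2 ℕ.* k     ∎)

  minus-sum : ∀ {k} j → Level k → 2 ℕ.* j ℕ.+ slice k ℕ.+ 2 ℕ.* k ≡ n-1 ℕ.+ 2 ℕ.* suc j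
  minus-sum {k} j lvl = begin
    2 ℕ.* j ℕ.+ slice k ℕ.+ 2 ℕ.* k   ≡⟨ ℕ.+-assoc (2 ℕ.* j) (slice k) (2 ℕ.* k) ⟩
    2 ℕ.* j ℕ.+ (slice k ℕ.+ 2 ℕ.* k) ≡⟨ cong (2 ℕ.* j ℕ.+_) (slice+2k lvl) ⟩
    2 ℕ.* j ℕ.+ (n ℕ.+ 1)             ≡⟨ solve 2 (λ q p → con 2 :* q :+ (con 1 :+ p :+ con 1) := p :+ con 2 :* (con 1 :+ q)) refl j n-1 ⟩
    n-1 ℕ.+ 2 ℕ.* suc j               ∎

  minus-index : ∀ {k j} → Level k → 2 ℕ.* j ℕ.+ slice k ≡ n-1 → suc j ≡ k
  minus-index {k} {j} lvl eq = ℕ.*-cancelˡ-≡ (suc j) k 2 (ℕ.+-cancelˡ-≡ n-1 _ _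
    (trans (sym (minus-sum j lvl)) (cong (ℕ._+ 2 ℕ.* k) eq)))

  index-minus : ∀ {k j} → Level k → suc j ≡ k → 2 ℕ.* j ℕ.+ slice k ≡ n-1
  index-minus {k} {j} lvl refl = ℕ.+-cancelʳ-≡ (2 ℕ.* k) _ _ (minus-sum j lvl)

  grid-plus : ∀ {j m} → 2 ℕ.* j ≡ m ℕ.+ n-1 → gridCoord n j ≡ signed + m
  grid-plus {j} {m} eq = begin
    ℤ.+ (2 ℕ.* j) ℤ.- ℤ.+ n-1   ≡⟨ cong (λ a → ℤ.+ a ℤ.- ℤ.+ n-1) eq ⟩
    ℤ.+ (m ℕ.+ n-1) ℤ.- ℤ.+ n-1 ≡⟨ ℤ.m-n≡m⊖n (m ℕ.+ n-1) n-1 ⟩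
    (m ℕ.+ n-1) ℤ.⊖ n-1         ≡⟨ ℤ.⊖-≥ (ℕ.m≤n+m n-1 m) ⟩
    ℤ.+ (m ℕ.+ n-1 ∸ n-1)       ≡⟨ cong ℤ.+_ (ℕ.m+n∸n≡m m n-1) ⟩
    ℤ.+ m                       ∎

  grid-minus : ∀ {j m} → 2 ℕ.* j ℕ.+ m ≡ n-1 → gridCoord n j ≡ signed - m
  grid-minus {j} {m} eq = begin
    ℤ.+ (2 ℕ.* j) ℤ.- ℤ.+ n-1                 ≡⟨ cong (λ a → ℤ.+ (2 ℕ.* j) ℤ.- ℤ.+ a) eq ⟨
    ℤ.+ (2 ℕ.* j) ℤ.- ℤ.+ (2 ℕ.* j ℕ.+ m)     ≡⟨ ℤ.m-n≡m⊖n (2 ℕ.* j) (2 ℕ.* j ℕ.+ m) ⟩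
    (2 ℕ.* j) ℤ.⊖ (2 ℕ.* j ℕ.+ m)             ≡⟨ ℤ.⊖-≤ (ℕ.m≤m+n (2 ℕ.* j) m) ⟩
    ℤ.- ℤ.+ (2 ℕ.* j ℕ.+ m ∸ 2 ℕ.* j)         ≡⟨ cong (λ a → ℤ.- ℤ.+ a) (ℕ.m+n∸m≡n (2 ℕ.* j) m) ⟩
    ℤ.- ℤ.+ m                                 ∎

  -- Says that `2j - (n - 1)` is `m` with the given sign, in a form free of truncated subtraction. A
  -- middle index satisfies it with `m = 0` for both signs.
  Distance : ℕ → Sign → ℕ → Set
  Distance j + m = 2 ℕ.* j ≡ m ℕ.+ n-1
  Distance j - m = 2 ℕ.* j ℕ.+ m ≡ n-1

  distance : ∀ j → ∃ λ s → ∃ λ m → Distance j s m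
  distance j with ℕ.≤-total n-1 (2 ℕ.* j)
  ... | inj₁ n-1≤2j = + , 2 ℕ.* j ∸ n-1 , sym (ℕ.m∸n+n≡m n-1≤2j)
  ... | inj₂ 2j≤n-1 = - , n-1 ∸ 2 ℕ.* j , ℕ.m+[n∸m]≡n 2j≤n-1

  grid-distance : ∀ {j} s {m} → Distance j s m → gridCoord n j ≡ signed s m
  grid-distance {j} + = grid-plus {j}
  grid-distance {j} - = grid-minus {j}

  distance-index : ∀ {j k} s → Level k → Distance j s (slice k) → j ≡ k ∸ 1 ⊎ j ≡ n ∸ k
  distance-index {j} {k} + lvl eq = inj₂ (trans (sym (ℕ.m+n∸n≡m j k)) (cong (_∸ k) (plus-index lvl eq)))
  distance-index - lvl eq = inj₁ (cong (_∸ 1) (minus-index lvl eq))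

  -- With sign plus, `2j = 2n - 1` fails by parity; with sign minus, the left side is too large.
  distance≢n : ∀ {j} s → ¬ Distance j s n
  distance≢n {j} + eq = ℕ.even≢odd n j (begin
    2 ℕ.* n          ≡⟨ solve 1 (λ p → con 2 :* (con 1 :+ p) := con 1 :+ (con 1 :+ p :+ p)) refl n-1 ⟩
    suc (n ℕ.+ n-1)  ≡⟨ cong suc eq ⟨
    suc (2 ℕ.* j)    ∎)
  distance≢n {j} - eq = ℕ.<-irrefl (sym eq) (ℕ.m≤n+m n (2 ℕ.* j))

  index : ∀ {k} → Level k → Sign → Fin n
  index {suc k} (_ , 2k≤n) + = fromℕ< {n ∸ suc k} (s≤s (ℕ.m∸n≤m n-1 k))
  index {suc k} (_ , 2k≤n) - = fromℕ< {k} (ℕ.≤-trans (ℕ.m≤m+n (suc k) _) 2k≤n)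

  toℕ-index-plus : ∀ {k} (lvl : Level k) → toℕ (index lvl +) ≡ n ∸ k
  toℕ-index-plus {suc k} _ = Fin.toℕ-fromℕ< _

  toℕ-index-minus : ∀ {k} (lvl : Level k) → toℕ (index lvl -) ≡ k ∸ 1
  toℕ-index-minus {suc k} _ = Fin.toℕ-fromℕ< _

  index-coord : ∀ {k} (lvl : Level k) s → gridCoord n (toℕ (index lvl s)) ≡ signed s (slice k)
  index-coord {suc k} lvl@(_ , 2k≤n) + rewrite toℕ-index-plus lvl =
    grid-plus {n ∸ suc k} (index-plus lvl (ℕ.m∸n+n≡m (ℕ.≤-trans (ℕ.m≤m+n (suc k) _) 2k≤n)))
  index-coord {suc k} lvl - rewrite toℕ-index-minus lvl = grid-minus {k} (index-minus lvl refl)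

  index-complete : ∀ {k} (lvl : Level k) {r : Fin n} → toℕ r ≡ k ∸ 1 ⊎ toℕ r ≡ n ∸ k → ∃ λ s → index lvl s ≡ r
  index-complete lvl (inj₁ eq) = - , Fin.toℕ-injective (trans (toℕ-index-minus lvl) (sym eq))
  index-complete lvl (inj₂ eq) = + , Fin.toℕ-injective (trans (toℕ-index-plus lvl) (sym eq))

  -- Slice membership and the layers that matter

  inSlice? : ℕ → ℤ → Bool
  inSlice? k v = ⌊ v ℤ.≟ ℤ.+ slice k ⌋ ∨ ((k ≡ᵇ 1) ∧ ⌊ v ℤ.≟ ℤ.+ n ⌋)

  slice-hit : ∀ k → inSlice? k (ℤ.+ slice k) ≡ true
  slice-hit k rewrite isYes-true (ℤ.+ slice k ℤ.≟ ℤ.+ slice k) refl = refl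

  face-hit : inSlice? 1 (ℤ.+ n) ≡ true
  face-hit = trans (cong (⌊ ℤ.+ n ℤ.≟ ℤ.+ slice 1 ⌋ ∨_) (isYes-true (ℤ.+ n ℤ.≟ ℤ.+ n) refl)) (∨-zeroʳ _)

  slice-miss : ∀ k {v} → v ≢ ℤ.+ slice k → (k ≡ 1 → v ≢ ℤ.+ n) → inSlice? k v ≡ false
  slice-miss k {v} v≢slice v≢n rewrite isYes-false (v ℤ.≟ ℤ.+ slice k) v≢slice = face-miss k v≢n
    where
    face-miss : ∀ k → (k ≡ 1 → v ≢ ℤ.+ n) → (k ≡ᵇ 1) ∧ ⌊ v ℤ.≟ ℤ.+ n ⌋ ≡ false
    face-miss 0             _   = refl
    face-miss 1             v≢n = isYes-false (v ℤ.≟ ℤ.+ n) (v≢n refl)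
    face-miss (suc (suc _)) _   = refl

  miss : ∀ k {m} → m ≢ slice k → m ≢ n → inSlice? k (ℤ.+ m) ≡ false
  miss k m≢slice m≢n = slice-miss k (m≢slice ∘ ℤ.+-injective) (λ _ → m≢n ∘ ℤ.+-injective)

  distinct : ∀ {j k} → Level j → Level k → j ≢ k → inSlice? k (ℤ.+ slice j) ≡ false
  distinct {j} {k} lvl-j lvl-k j≢k = miss k (j≢k ∘ slice-injective lvl-j lvl-k) (slice≢n lvl-j)

  face-only-1 : ∀ {k} → Level k → k ≢ 1 → inSlice? k (ℤ.+ n) ≡ false
  face-only-1 {k} lvl k≢1 =
    slice-miss k (slice≢n lvl ∘ sym ∘ ℤ.+-injective) (λ k≡1 → contradiction k≡1 k≢1)

  -- A turn of a layer other than 1 and `i` moves no sticker of either shell; it becomes `nothing`.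
  data DepthView (k : ℕ) : Maybe Depth → Set where
    is-outer : k ≡ 1 → DepthView k (just outer)
    is-inner : k ≡ i → DepthView k (just inner)
    is-other : k ≢ 1 → k ≢ i → DepthView k nothing

  depth-view : ∀ k → ∃ (DepthView k)
  depth-view k with k ℕ.≟ 1 | k ℕ.≟ i
  ... | yes k≡1 | _       = _ , is-outer k≡1
  ... | no _    | yes k≡i = _ , is-inner k≡i
  ... | no k≢1  | no k≢i  = _ , is-other k≢1 k≢i

  depth : ℕ → Maybe Depth
  depth k = proj₁ (depth-view k)

  meets : Maybe Depth → Sym → Bool
  meets nothing  _ = false
  meets (just d) s = hits d s

  meets-minus : ∀ d b → meets d (- , b) ≡ false
  meets-minus nothing      b = refl
  meets-minus (just outer) b = refl
  meets-minus (just inner) b = refl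

  move? : Face → Maybe Depth → Bool → SymPoint → SymPoint
  move? f nothing  inv p = p
  move? f (just d) inv p = moveₛ (f , d , inv) p

  letterDepth : Fin (n / 2) → Maybe Depth
  letterDepth k = depth (suc (toℕ k))

  letter-level : (k : Fin (n / 2)) → Level (suc (toℕ k))
  letter-level k = half-level (s≤s z≤n) (Fin.toℕ<n k)

  1+[i-1]≡i : suc (i ∸ 1) ≡ i
  1+[i-1]≡i = ℕ.m+[n∸m]≡n 1≤i

  layer : Depth → Fin (n / 2)
  layer outer = fromℕ< {0} 1≤n/2
  layer inner = fromℕ< {i ∸ 1} (subst (_≤ n / 2) (sym 1+[i-1]≡i) i≤n/2)

  depthIndex : Depth → ℕ
  depthIndex outer = 1
  depthIndex inner = i

  suc-layer : ∀ d → suc (toℕ (layer d)) ≡ depthIndex d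
  suc-layer outer = cong suc (Fin.toℕ-fromℕ< {0} 1≤n/2)
  suc-layer inner = trans (cong suc (Fin.toℕ-fromℕ< _)) 1+[i-1]≡i

  depth-index : ∀ d → depth (depthIndex d) ≡ just d
  depth-index outer = refl
  depth-index inner with i ℕ.≟ 1 | i ℕ.≟ i
  ... | yes i≡1 | _      = contradiction i≡1 i≢1
  ... | no _    | yes _  = refl
  ... | no _    | no i≢i = contradiction refl i≢i

  letterDepth-layer : ∀ d → letterDepth (layer d) ≡ just d
  letterDepth-layer d = trans (cong depth (suc-layer d)) (depth-index d)

  realise : SymWord → Word n
  realise = map (λ (f , d , inv) → (f , layer d , inv))

  Free : ℕ → Set
  Free m = (∀ d → m ≢ slice (depthIndex d)) × m ≢ n

  -- Interpretation of symbolic points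

  module Valuation (x y : ℕ) where

    value : Base → ℕ
    value N = n
    value A = slice i
    value E = slice 1
    value X = x
    value Y = y

    coord : Sym → ℤ
    coord (s , b) = signed s (value b)

    ⟦_⟧ : SymPoint → Point
    ⟦ (a , b , c) ⟧ = (coord a , coord b , coord c)

    coord-negate : ∀ s → coord (negate s) ≡ ℤ.- coord s
    coord-negate (+ , b) = refl
    coord-negate (- , b) = sym (ℤ.neg-involutive _)

    normal-sound : ∀ f p → normalCoord f ⟦ p ⟧ ≡ coord (normalₛ f p)
    normal-sound 0F p           = refl
    normal-sound 1F (a , b , c) = sym (coord-negate a)
    normal-sound 2F p           = refl
    normal-sound 3F (a , b , c) = sym (coord-negate b)
    normal-sound 4F p           = refl
    normal-sound 5F (a , b , c) = sym (coord-negate c)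

    cw-sound : ∀ f p → cw f ⟦ p ⟧ ≡ ⟦ cwₛ f p ⟧
    cw-sound 0F (a , b , c) = cong (λ v → (coord a , coord c , v)) (sym (coord-negate b))
    cw-sound 1F (a , b , c) = cong (λ v → (coord a , v , coord b)) (sym (coord-negate c))
    cw-sound 2F (a , b , c) = cong (λ v → (v , coord b , coord a)) (sym (coord-negate c))
    cw-sound 3F (a , b , c) = cong (λ v → (coord c , coord b , v)) (sym (coord-negate a))
    cw-sound 4F (a , b , c) = cong (λ v → (coord b , v , coord c)) (sym (coord-negate a))
    cw-sound 5F (a , b , c) = cong (λ v → (v , coord a , coord c)) (sym (coord-negate b))

    -- The symbols `N`, `A`, `E` have known distances, which can be compared with any slice; for `X`
    -- and `Y` the miss has to be assumed.
    Admissible : ℕ → Base → Set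
    Admissible k X = x ≢ slice k × x ≢ n
    Admissible k Y = y ≢ slice k × y ≢ n
    Admissible k _ = ⊤

    slice-sound : ∀ {k d} → Level k → DepthView k d → ∀ s → Admissible k (base s) → inSlice? k (coord s) ≡ meets d s
    slice-sound {k} {d} lvl view (- , b) _ =
      trans (slice-miss k (minus≢plus (slice-positive lvl)) (λ _ → minus≢plus (s≤s z≤n))) (sym (meets-minus d b))
    slice-sound lvl (is-outer refl)     (+ , N) _ = face-hit
    slice-sound lvl (is-outer refl)     (+ , A) _ = distinct level-i lvl i≢1
    slice-sound lvl (is-outer refl)     (+ , E) _ = slice-hit 1
    slice-sound lvl (is-outer refl)     (+ , X) (x≢slice , x≢n) = miss 1 x≢slice x≢n
    slice-sound lvl (is-outer refl)     (+ , Y) (y≢slice , y≢n) = miss 1 y≢slice y≢n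
    slice-sound lvl (is-inner refl)     (+ , N) _ = face-only-1 lvl i≢1
    slice-sound lvl (is-inner refl)     (+ , A) _ = slice-hit i
    slice-sound lvl (is-inner refl)     (+ , E) _ = distinct level-1 lvl (i≢1 ∘ sym)
    slice-sound lvl (is-inner refl)     (+ , X) (x≢slice , x≢n) = miss i x≢slice x≢n
    slice-sound lvl (is-inner refl)     (+ , Y) (y≢slice , y≢n) = miss i y≢slice y≢n
    slice-sound lvl (is-other k≢1 _)    (+ , N) _ = face-only-1 lvl k≢1
    slice-sound lvl (is-other _ k≢i)    (+ , A) _ = distinct level-i lvl (k≢i ∘ sym)
    slice-sound lvl (is-other k≢1 _)    (+ , E) _ = distinct level-1 lvl (k≢1 ∘ sym)
    slice-sound {k} lvl (is-other _ _)  (+ , X) (x≢slice , x≢n) = miss k x≢slice x≢n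
    slice-sound {k} lvl (is-other _ _)  (+ , Y) (y≢slice , y≢n) = miss k y≢slice y≢n

    -- A rotation only permutes coordinates and changes signs, so it agrees with its symbolic form
    -- under any valuation. Distances enter through the slice test alone, which reads only the
    -- normal coordinate.
    move-sound : ∀ f k inv p → Admissible (suc (toℕ k)) (base (normalₛ f p)) →
                 moveAct n (f , k , inv) ⟦ p ⟧ ≡ ⟦ move? f (letterDepth k) inv p ⟧
    move-sound f k inv p adm
      rewrite normal-sound f p
            | slice-sound (letter-level k) (proj₂ (depth-view (suc (toℕ k)))) (normalₛ f p) adm
      = turn (letterDepth k) inv
      where
      turn : ∀ d inv → (if meets d (normalₛ f p) then (if inv then cw (opp f) ⟦ p ⟧ else cw f ⟦ p ⟧) else ⟦ p ⟧)
                       ≡ ⟦ move? f d inv p ⟧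
      turn nothing inv = refl
      turn (just d) inv with hits d (normalₛ f p)
      turn (just d) false | true  = cw-sound f p
      turn (just d) true  | true  = cw-sound (opp f) p
      turn (just d) inv   | false = refl

    free-admissible : Free x → Free y → ∀ d b → Admissible (suc (toℕ (layer d))) b
    free-admissible free-x free-y d N = tt
    free-admissible free-x free-y d A = tt
    free-admissible free-x free-y d E = tt
    free-admissible (x≢slice , x≢n) free-y d X = subst (λ k → Admissible k X) (sym (suc-layer d)) (x≢slice d , x≢n)
    free-admissible free-x (y≢slice , y≢n) d Y = subst (λ k → Admissible k Y) (sym (suc-layer d)) (y≢slice d , y≢n)

    act-realise : Free x → Free y → ∀ w p → act n (realise w) ⟦ p ⟧ ≡ ⟦ actₛ w p ⟧
    act-realise free-x free-y []                  p = refl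
    act-realise free-x free-y ((f , d , inv) ∷ w) p = begin
      act n (realise w) (moveAct n (f , layer d , inv) ⟦ p ⟧)
        ≡⟨ cong (act n (realise w)) (move-sound f (layer d) inv p (free-admissible free-x free-y d _)) ⟩
      act n (realise w) ⟦ move? f (letterDepth (layer d)) inv p ⟧
        ≡⟨ cong (λ e → act n (realise w) ⟦ move? f e inv p ⟧) (letterDepth-layer d) ⟩
      act n (realise w) ⟦ moveₛ (f , d , inv) p ⟧
        ≡⟨ act-realise free-x free-y w (moveₛ (f , d , inv) p) ⟩
      ⟦ actₛ w (moveₛ (f , d , inv) p) ⟧ ∎

    embed-sound : ∀ f {r c : Fin n} {a b} → gridCoord n (toℕ r) ≡ coord a → gridCoord n (toℕ c) ≡ coord b →
                  embed n (f , r , c) ≡ ⟦ facePoint f a b ⟧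
    embed-sound 0F eq₁ eq₂ = cong₂ (λ u v → (ℤ.+ n , u , v)) eq₁ eq₂
    embed-sound 1F eq₁ eq₂ = cong₂ (λ u v → (ℤ.- ℤ.+ n , u , v)) eq₁ eq₂
    embed-sound 2F eq₁ eq₂ = cong₂ (λ u v → (u , ℤ.+ n , v)) eq₁ eq₂
    embed-sound 3F eq₁ eq₂ = cong₂ (λ u v → (u , ℤ.- ℤ.+ n , v)) eq₁ eq₂
    embed-sound 4F eq₁ eq₂ = cong₂ (λ u v → (u , v , ℤ.+ n)) eq₁ eq₂
    embed-sound 5F eq₁ eq₂ = cong₂ (λ u v → (u , v , ℤ.- ℤ.+ n)) eq₁ eq₂

  -- Permutations of the shells and their signs

  letterPerm : Shell → Letter n → Permutation′ 24
  letterPerm h (f , k , inv) with letterDepth k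
  ... | nothing = Perm.id
  ... | just d  = stepPerm h (f , d , inv)

  perm : Shell → Word n → Permutation′ 24
  perm h []      = Perm.id
  perm h (l ∷ w) = letterPerm h l ∘ₚ perm h w

  perm-++ : ∀ h w v x → perm h (w ++ v) ⟨$⟩ʳ x ≡ perm h v ⟨$⟩ʳ (perm h w ⟨$⟩ʳ x)
  perm-++ h []      v x = refl
  perm-++ h (l ∷ w) v x = perm-++ h w v (letterPerm h l ⟨$⟩ʳ x)

  letterTs : Shell → Letter n → List (Transp 24)
  letterTs h (f , k , inv) with letterDepth k
  ... | nothing = []
  ... | just d  = stepTs h (f , d , inv)

  -- A word acts by its first letter first, `applyTs` by its last transposition first; hence the
  -- reversed order.
  permTs : Shell → Word n → List (Transp 24)
  permTs h []      = []
  permTs h (l ∷ w) = permTs h w ++ letterTs h l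

  letterTs-correct : ∀ h l x → letterPerm h l ⟨$⟩ʳ x ≡ applyTs (letterTs h l) x
  letterTs-correct h (f , k , inv) x with letterDepth k
  ... | nothing = refl
  ... | just d  = proj₂ (stepTs-spec h f d inv) x

  permTs-correct : ∀ h w x → perm h w ⟨$⟩ʳ x ≡ applyTs (permTs h w) x
  permTs-correct h []      x = refl
  permTs-correct h (l ∷ w) x = begin
    perm h w ⟨$⟩ʳ (letterPerm h l ⟨$⟩ʳ x)          ≡⟨ permTs-correct h w _ ⟩
    applyTs (permTs h w) (letterPerm h l ⟨$⟩ʳ x)   ≡⟨ cong (applyTs (permTs h w)) (letterTs-correct h l x) ⟩
    applyTs (permTs h w) (applyTs (letterTs h l) x) ≡⟨ applyTs-++ (permTs h w) (letterTs h l) x ⟨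
    applyTs (permTs h w ++ letterTs h l) x          ∎

  letterTs-parity : ∀ l → parity (length (letterTs centre l)) ≡ parity (length (letterTs corner l))
  letterTs-parity (f , k , inv) with letterDepth k
  ... | nothing = refl
  ... | just d  = trans (proj₁ (stepTs-spec centre f d inv)) (sym (proj₁ (stepTs-spec corner f d inv)))

  permTs-parity : ∀ w → parity (length (permTs centre w)) ≡ parity (length (permTs corner w))
  permTs-parity []      = refl
  permTs-parity (l ∷ w) = begin
    parity (length (permTs centre w ++ letterTs centre l))
      ≡⟨ length-++-parity (permTs centre w) _ ⟩
    parity (length (permTs centre w)) ℙ.+ parity (length (letterTs centre l))
      ≡⟨ cong₂ ℙ._+_ (permTs-parity w) (letterTs-parity l) ⟩
    parity (length (permTs corner w)) ℙ.+ parity (length (letterTs corner l))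
      ≡⟨ length-++-parity (permTs corner w) _ ⟨
    parity (length (permTs corner w ++ letterTs corner l)) ∎

  -- Facelets of the shells

  shellLevel : Shell → ∃ Level
  shellLevel centre = i , level-i
  shellLevel corner = 1 , level-1

  shellIndex : Shell → Sign → Fin n
  shellIndex h = index (proj₂ (shellLevel h))

  facelet : Shell → Fin 24 → Facelet n
  facelet h x = (cellFace x , shellIndex h (cellSign₁ x) , shellIndex h (cellSign₂ x))

  facelet-cell : ∀ h f s t → facelet h (cell f s t) ≡ (f , shellIndex h s , shellIndex h t)
  facelet-cell h f s t =
    cong (λ (f , s , t) → (f , shellIndex h s , shellIndex h t)) (coordinates-cell f s t)

  -- Shell points involve no free distance, so the values of X and Y do not matter here.
  open Valuation 0 0

  shell-coord : ∀ h s → gridCoord n (toℕ (shellIndex h s)) ≡ coord (s , shellBase h)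
  shell-coord centre = index-coord level-i
  shell-coord corner = index-coord level-1

  facelet-sound : ∀ h x → embed n (facelet h x) ≡ ⟦ point h x ⟧
  facelet-sound h x = embed-sound (cellFace x) (shell-coord h _) (shell-coord h _)

  -- The symbols with distinct positive values. On them the interpretation is injective, whereas `X`
  -- and `Y` both have value 0 here.
  data Ground : Base → Set where
    N! : Ground N
    A! : Ground A
    E! : Ground E

  ground-admissible : ∀ k {b} → Ground b → Admissible k b
  ground-admissible k N! = tt
  ground-admissible k A! = tt
  ground-admissible k E! = tt

  GroundPoint : SymPoint → Set
  GroundPoint (a , b , c) = Ground (base a) × Ground (base b) × Ground (base c)

  ground-shell : ∀ h → Ground (shellBase h)
  ground-shell centre = A!
  ground-shell corner = E!

  ground-face : ∀ f {a b} → Ground (base a) → Ground (base b) → GroundPoint (facePoint f a b)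
  ground-face 0F ga gb = (N! , ga , gb)
  ground-face 1F ga gb = (N! , ga , gb)
  ground-face 2F ga gb = (ga , N! , gb)
  ground-face 3F ga gb = (ga , N! , gb)
  ground-face 4F ga gb = (ga , gb , N!)
  ground-face 5F ga gb = (ga , gb , N!)

  ground-point : ∀ h x → GroundPoint (point h x)
  ground-point h x = ground-face (cellFace x) (ground-shell h) (ground-shell h)

  ground-normal : ∀ f p → GroundPoint p → Ground (base (normalₛ f p))
  ground-normal 0F p           (ga , _ , _) = ga
  ground-normal 1F (a , _ , _) (ga , _ , _) = subst Ground (sym (base-negate a)) ga
  ground-normal 2F p           (_ , gb , _) = gb
  ground-normal 3F (_ , b , _) (_ , gb , _) = subst Ground (sym (base-negate b)) gb
  ground-normal 4F p           (_ , _ , gc) = gc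
  ground-normal 5F (_ , _ , c) (_ , _ , gc) = subst Ground (sym (base-negate c)) gc

  letter-point : ∀ h l x → moveAct n l ⟦ point h x ⟧ ≡ ⟦ point h (letterPerm h l ⟨$⟩ʳ x) ⟧
  letter-point h (f , k , inv) x =
    trans (move-sound f k inv (point h x) (ground-admissible _ (ground-normal f (point h x) (ground-point h x)))) follow
    where
    follow : ⟦ move? f (letterDepth k) inv (point h x) ⟧ ≡ ⟦ point h (letterPerm h (f , k , inv) ⟨$⟩ʳ x) ⟧
    follow with letterDepth k
    ... | nothing = refl
    ... | just d  = cong ⟦_⟧ (sym (proj₁ (step-spec h (f , d , inv) x)))

  act-point : ∀ h w x → act n w ⟦ point h x ⟧ ≡ ⟦ point h (perm h w ⟨$⟩ʳ x) ⟧
  act-point h []      x = refl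
  act-point h (l ∷ w) x = trans (cong (act n w) (letter-point h l x)) (act-point h w (letterPerm h l ⟨$⟩ʳ x))

  act-facelet : ∀ h w x → act n w (embed n (facelet h x)) ≡ ⟦ point h (perm h w ⟨$⟩ʳ x) ⟧
  act-facelet h w x = trans (cong (act n w) (facelet-sound h x)) (act-point h w x)

  value-positive : ∀ {b} → Ground b → 0 < value b
  value-positive N! = s≤s z≤n
  value-positive A! = slice-positive level-i
  value-positive E! = slice-positive level-1

  value-injective : ∀ {b c} → Ground b → Ground c → value b ≡ value c → b ≡ c
  value-injective N! N! _  = refl
  value-injective N! A! eq = contradiction (sym eq) (slice≢n level-i)
  value-injective N! E! eq = contradiction (sym eq) (slice≢n level-1)
  value-injective A! N! eq = contradiction eq (slice≢n level-i)
  value-injective A! A! _  = refl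
  value-injective A! E! eq = contradiction (slice-injective level-i level-1 eq) i≢1
  value-injective E! N! eq = contradiction eq (slice≢n level-1)
  value-injective E! A! eq = contradiction (slice-injective level-i level-1 (sym eq)) i≢1
  value-injective E! E! _  = refl

  coord-injective : ∀ {a b} → Ground (base a) → Ground (base b) → coord a ≡ coord b → a ≡ b
  coord-injective {s , b} {t , c} gb gc eq
    with refl , eq′ ← signed-injective {s} {t} (value-positive gb) (value-positive gc) eq
    = cong (s ,_) (value-injective gb gc eq′)

  ⟦⟧-injective : ∀ {p q} → GroundPoint p → GroundPoint q → ⟦ p ⟧ ≡ ⟦ q ⟧ → p ≡ q
  ⟦⟧-injective (ga , gb , gc) (ha , hb , hc) eq =
    cong₂ _,_ (coord-injective ga ha (cong proj₁ eq))
      (cong₂ _,_ (coord-injective gb hb (cong (proj₁ ∘ proj₂) eq)) (coord-injective gc hc (cong (proj₂ ∘ proj₂) eq)))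

  point-injective : ∀ h {x y} → ⟦ point h x ⟧ ≡ ⟦ point h y ⟧ → x ≡ y
  point-injective h {x} {y} eq = begin
    x                   ≡⟨ locate-point h x ⟨
    locate (point h x)  ≡⟨ cong locate (⟦⟧-injective {point h x} {point h y} (ground-point h x) (ground-point h y) eq) ⟩
    locate (point h y)  ≡⟨ locate-point h y ⟩
    y                   ∎

  -- Restriction to the orbit: injectivity and evenness

  inOrbit? : (f : Facelet n) → Dec (InOrbit n i f)
  inOrbit? (f , r , c) =
    ((toℕ r ℕ.≟ i ∸ 1) ⊎-dec (toℕ r ℕ.≟ n ∸ i)) ×-dec ((toℕ c ℕ.≟ i ∸ 1) ⊎-dec (toℕ c ℕ.≟ n ∸ i))

  orbit-complete : ∀ f → InOrbit n i f → ∃ λ x → facelet centre x ≡ f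
  orbit-complete (f , r , c) (r∈ , c∈)
    with s , refl ← index-complete level-i r∈ | t , refl ← index-complete level-i c∈
    = cell f s t , facelet-cell centre f s t

  -- The row alone decides: a common row index would equate the distances of layers `i` and 1.
  corner-outside : ∀ x → ¬ InOrbit n i (facelet corner x)
  corner-outside x (r∈ , _) with s , eq ← index-complete level-i r∈ = i≢1 (slice-injective level-i level-1
    (proj₂ (signed-injective {s} {cellSign₁ x} (slice-positive level-i) (slice-positive level-1) (begin
      signed s (slice i)                                 ≡⟨ index-coord level-i s ⟨
      gridCoord n (toℕ (index level-i s))                ≡⟨ cong (λ r → gridCoord n (toℕ r)) eq ⟩
      gridCoord n (toℕ (index level-1 (cellSign₁ x)))    ≡⟨ index-coord level-1 (cellSign₁ x) ⟩
      signed (cellSign₁ x) (slice 1)                     ∎))))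

  perm-cong : ∀ w v → SameInG n w v → ∀ x → perm centre w ⟨$⟩ʳ x ≡ perm centre v ⟨$⟩ʳ x
  perm-cong w v same x = point-injective centre (begin
    ⟦ point centre (perm centre w ⟨$⟩ʳ x) ⟧  ≡⟨ act-facelet centre w x ⟨
    act n w (embed n (facelet centre x))     ≡⟨ same (facelet centre x) ⟩
    act n v (embed n (facelet centre x))     ≡⟨ act-facelet centre v x ⟩
    ⟦ point centre (perm centre v ⟨$⟩ʳ x) ⟧  ∎)

  perm-injective : ∀ w v → InZ n i w → InZ n i v →
                   (∀ x → perm centre w ⟨$⟩ʳ x ≡ perm centre v ⟨$⟩ʳ x) → SameInG n w v
  perm-injective w v w∈Z v∈Z eq f with inOrbit? f
  ... | no f∉ = trans (w∈Z f f∉) (sym (v∈Z f f∉))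
  ... | yes f∈ with x , refl ← orbit-complete f f∈ = begin
    act n w (embed n (facelet centre x))     ≡⟨ act-facelet centre w x ⟩
    ⟦ point centre (perm centre w ⟨$⟩ʳ x) ⟧  ≡⟨ cong (λ y → ⟦ point centre y ⟧) (eq x) ⟩
    ⟦ point centre (perm centre v ⟨$⟩ʳ x) ⟧  ≡⟨ act-facelet centre v x ⟨
    act n v (embed n (facelet centre x))     ∎

  corner-fixed : ∀ w → InZ n i w → ∀ x → perm corner w ⟨$⟩ʳ x ≡ x
  corner-fixed w w∈Z x = point-injective corner (begin
    ⟦ point corner (perm corner w ⟨$⟩ʳ x) ⟧  ≡⟨ act-facelet corner w x ⟨
    act n w (embed n (facelet corner x))     ≡⟨ w∈Z (facelet corner x) (corner-outside x) ⟩
    embed n (facelet corner x)               ≡⟨ facelet-sound corner x ⟩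
    ⟦ point corner x ⟧                       ∎)

  perm-even : ∀ w → InZ n i w → IsEven (perm centre w)
  perm-even w w∈Z = permTs centre w , even-half _ even , permTs-correct centre w
    where
    even : parity (length (permTs centre w)) ≡ 0ℙ
    -- The sign is moved from the orbit to the corners, where the word acts as the identity.
    even = trans (permTs-parity w)
      (identity-even (permTs corner w) (λ x → trans (sym (permTs-correct corner w x)) (corner-fixed w w∈Z x)))

  perm-realise : ∀ w x → perm centre (realise w) ⟨$⟩ʳ x ≡ run w x
  perm-realise []                  x = refl
  perm-realise ((f , d , inv) ∷ w) x rewrite letterDepth-layer d = perm-realise w (step centre (f , d , inv) x)

  -- The three-cycles fix all facelets outside the orbit

  zero-free : Free 0
  zero-free = (λ { outer → ℕ.<⇒≢ (slice-positive level-1) ; inner → ℕ.<⇒≢ (slice-positive level-i) }) , λ ()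

  named : Fin 3 → ℕ → ℕ
  named 0F m = slice i
  named 1F m = slice 1
  named 2F m = m

  named-slot₁ : ∀ x y b s → signed s (named b x) ≡ Valuation.coord x y (s , slot₁ b)
  named-slot₁ x y 0F s = refl
  named-slot₁ x y 1F s = refl
  named-slot₁ x y 2F s = refl

  named-slot₂ : ∀ x y b s → signed s (named b y) ≡ Valuation.coord x y (s , slot₂ b)
  named-slot₂ x y 0F s = refl
  named-slot₂ x y 1F s = refl
  named-slot₂ x y 2F s = refl

  -- Here `b` chooses the slot and `m` is the value to be given to `X` or `Y`. The last component
  -- turns a facelet with both slots `0F` into one of the orbit.
  CoordView : Fin n → Set
  CoordView r = ∃ λ s → ∃ λ b → ∃ λ m →
    Free m × gridCoord n (toℕ r) ≡ signed s (named b m) × (b ≡ 0F → toℕ r ≡ i ∸ 1 ⊎ toℕ r ≡ n ∸ i)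

  coord-view : ∀ r → CoordView r
  coord-view r with s , m , dist ← distance (toℕ r) = view (m ℕ.≟ slice i) (m ℕ.≟ slice 1)
    where
    view : Dec (m ≡ slice i) → Dec (m ≡ slice 1) → CoordView r
    -- In this slot the free symbol does not occur, but its value must still be free; 0 is, because
    -- layers and faces have positive distances.
    view (yes refl) _          = s , 0F , 0 , zero-free , grid-distance s dist , λ _ → distance-index s level-i dist
    view (no _)     (yes refl) = s , 1F , 0 , zero-free , grid-distance s dist , λ ()
    view (no m≢i)   (no m≢1)   =
      s , 2F , m , ((λ { outer → m≢1 ; inner → m≢i }) , λ { refl → distance≢n {toℕ r} s dist }) , grid-distance s dist , λ ()

  -- The valuation depends on the facelet: its two distances become the values of `X` and `Y`, and
  -- the symbolic check then applies.
  threeCycle-InZ : ∀ j → InZ n i (realise (threeCycle j))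
  threeCycle-InZ j (f , r , c) f∉
    with s , b , x , free-x , eq-r , orbit-r ← coord-view r
       | t , b′ , y , free-y , eq-c , orbit-c ← coord-view c = begin
    act n (realise (threeCycle j)) (embed n (f , r , c))  ≡⟨ cong (act n (realise (threeCycle j))) embed≡ ⟩
    act n (realise (threeCycle j)) V.⟦ p ⟧                ≡⟨ V.act-realise free-x free-y (threeCycle j) p ⟩
    V.⟦ actₛ (threeCycle j) p ⟧                           ≡⟨ cong V.⟦_⟧ (threeCycle-fixes j f s t b b′ outside) ⟩
    V.⟦ p ⟧                                               ≡⟨ embed≡ ⟨
    embed n (f , r , c)                                   ∎
    where
    module V = Valuation x y
    p : SymPoint
    p = facePoint f (s , slot₁ b) (t , slot₂ b′)
    embed≡ : embed n (f , r , c) ≡ V.⟦ p ⟧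
    embed≡ = V.embed-sound f (trans eq-r (named-slot₁ x y b s)) (trans eq-c (named-slot₂ x y b′ t))
    outside : ¬ (b ≡ 0F × b′ ≡ 0F)
    outside (b≡A , b′≡A) = f∉ (orbit-r b≡A , orbit-c b′≡A)

  act-++ : ∀ w v p → act n (w ++ v) p ≡ act n v (act n w p)
  act-++ []      v p = refl
  act-++ (l ∷ w) v p = act-++ w v (moveAct n l p)

  -- Generation of the alternating group

  Realised : (Fin 24 → Fin 24) → Set
  Realised g = Σ (Word n) λ w → InZ n i w × (∀ x → perm centre w ⟨$⟩ʳ x ≡ g x)

  realised-cong : ∀ {g h} → (∀ x → g x ≡ h x) → Realised g → Realised h
  realised-cong g≗h (w , w∈Z , w≗g) = w , w∈Z , λ x → trans (w≗g x) (g≗h x)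

  infixr 9 _∘ᵣ_
  _∘ᵣ_ : ∀ {g h} → Realised g → Realised h → Realised (g ∘ h)
  -- Words act from left to right, so the word of the inner function comes first.
  _∘ᵣ_ {g} {h} (w , w∈Z , w≗g) (v , v∈Z , v≗h) = v ++ w ,
    (λ f f∉ → trans (act-++ v w (embed n f)) (trans (cong (act n w) (v∈Z f f∉)) (w∈Z f f∉))) ,
    (λ x → trans (perm-++ centre v w x) (trans (w≗g (perm centre v ⟨$⟩ʳ x)) (cong g (v≗h x))))

  star-τ : ∀ j → Realised (star j ∘ τ)
  star-τ j = realise (threeCycle j) , threeCycle-InZ j ,
    λ x → trans (perm-realise (threeCycle j) x) (run-threeCycle j x)

  -- This is the inverse of `star j ∘ τ`, whose cube is the identity, hence its square.
  τ-star : ∀ j → Realised (τ ∘ star j)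
  τ-star j = realised-cong (square j) (star-τ j ∘ᵣ star-τ j)
    where
    square : ∀ j x → star j (τ (star j (τ x))) ≡ τ (star j x)
    square = from-yes (Fin.all? λ j → Fin.all? λ x → star j (τ (star j (τ x))) Fin.≟ τ (star j x))

  -- The fixed odd factor `τ` makes a single transposition even. Away from 0, `swap (suc a) (suc b)`
  -- is a product of three stars; inserting `τ ∘ τ` between the first two gives three realised
  -- factors.
  swap-τ : ∀ {a b} → a ≢ b → Realised (swap a b ∘ τ)
  swap-τ {zero}  {zero}  a≢b = contradiction refl a≢b
  swap-τ {zero}  {suc b} _   = star-τ b
  swap-τ {suc a} {zero}  _   = realised-cong (λ x → swap-comm 0F (suc a) (τ x)) (star-τ a)
  swap-τ {suc a} {suc b} a≢b = realised-cong
    (λ x → trans (cong (star a) (swap-involutive 0F 1F (star b (star a (τ x))))) (swap-stars (a≢b ∘ cong suc) (τ x)))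
    (star-τ a ∘ᵣ τ-star b ∘ᵣ star-τ a)

  τ-swap : ∀ {a b} → a ≢ b → Realised (τ ∘ swap a b)
  τ-swap {zero}  {zero}  a≢b = contradiction refl a≢b
  τ-swap {zero}  {suc b} _   = τ-star b
  τ-swap {suc a} {zero}  _   = realised-cong (λ x → cong τ (swap-comm 0F (suc a) x)) (τ-star a)
  τ-swap {suc a} {suc b} a≢b = realised-cong
    (λ x → cong τ (trans (cong (star a ∘ star b) (swap-involutive 0F 1F (star a x))) (swap-stars (a≢b ∘ cong suc) x)))
    (τ-star a ∘ᵣ star-τ b ∘ᵣ τ-star a)

  -- Transpositions are taken in pairs, with `τ ∘ τ` inserted inside each pair.
  realised-even : ∀ ts k → length ts ≡ 2 ℕ.* k → Realised (applyTs ts)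
  realised-even []          k       _  = [] , (λ _ _ → refl) , λ _ → refl
  realised-even (_ ∷ [])    k       eq = contradiction (sym eq) (ℕ.even≢odd k 0)
  realised-even (((a , b) , a≢b) ∷ ((c , d) , c≢d) ∷ ts) (suc k) eq = realised-cong
    (λ x → cong (swap a b) (swap-involutive 0F 1F (swap c d (applyTs ts x))))
    (swap-τ a≢b ∘ᵣ τ-swap c≢d ∘ᵣ realised-even ts k
      (ℕ.suc-injective (ℕ.suc-injective (trans eq (ℕ.*-suc 2 k)))))

  iso : ZIsoA24 n i
  iso = record
    { φ      = perm centre
    ; φ-cong = λ w v _ _ → perm-cong w v
    ; φ-hom  = λ w v _ _ → perm-++ centre w v
    ; φ-inj  = perm-injective
    ; φ-even = perm-even
    ; φ-surj = λ { σ (ts , (k , length≡) , σ≗ts) →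
        realised-cong (λ x → sym (σ≗ts x)) (realised-even ts k length≡) }
    }

theorem12 : (n i : ℕ) → 4 ≤ n → 2 ≤ i → i ≤ n / 2 → ZIsoA24 n i
theorem12 (suc n-1) i _ 2≤i i≤n/2 = Cube.iso n-1 i 2≤i i≤n/2
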